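{- Let $D$ be a positive integer and let $G$ be a graph with $\Delta(G)\le D$. If $G$ is nice with respect to some maximum clique $S$ of $G^2$, then $\omega(G^2)\le \frac52 D$.
   Context: The square $G^2$ of $G$ is obtained from $G$ by adding an edge between every pair of vertices at distance 2 in $G$. A $k$-degeneracy order of a graph is an ordering of its vertices such that each vertex has at most $k$ neighbors later in the order. A graph $G$ is nice with respect to a vertex set $S$ if (a) $S$ is a clique in $G^2$, (b) $S$ is an independent set in $G$, and (c) $G$ has a 2-degeneracy order in which all vertices of $S$ appear consecutively. -}

module Defs where

open import Data.Bool.Base using (true; false)
open import Data.Fin.Base using (Fin) renaming (_≤_ to _≤ᶠ_)
open import Data.Fin.Permutation using (Permutation′; _⟨$⟩ʳ_)
open import Data.Fin.Properties using (all?; any?; _≟_; _<?_)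
open import Data.Fin.Subset using (Subset; _∈_; ∣_∣)
open import Data.Fin.Subset.Properties using (_∈?_)
open import Data.List.Base using (List; []; _∷_; _++_; map; filter; allFin)
open import Data.List.Extrema.Nat using (max)
open import Data.Nat.Base using (ℕ; zero; suc; _≤_; z≤n; s≤s)
open import Data.Product.Base using (∃-syntax; _×_; _,_)
open import Data.Sum.Base using (_⊎_; inj₁; inj₂)
open import Data.Vec.Base as Vec using (tabulate)
open import Level using (0ℓ)
open import Relation.Binary.Core using (Rel)
open import Relation.Binary.Definitions using (Decidable; Symmetric; Irreflexive)
open import Relation.Binary.PropositionalEquality using (_≡_; _≢_; refl; sym; ≢-sym)
open import Relation.Nullary using (¬_; does; contradiction)
open import Relation.Nullary.Decidable using (map′; ¬?; _×-dec_; _⊎-dec_; _→-dec_)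
import Relation.Unary as U

private
  variable
    n : ℕ

-- A finite simple graph on the vertex set Fin n.
record Graph (n : ℕ) : Set₁ where
  field
    Adj    : Rel (Fin n) 0ℓ
    adj?   : Decidable Adj
    symm   : Symmetric Adj
    irrefl : Irreflexive _≡_ Adj

open Graph

comprehension : {P : U.Pred (Fin n) 0ℓ} → U.Decidable P → Subset n
comprehension P? = tabulate (λ v → does (P? v))

subsets : ∀ n → List (Subset n)
subsets zero    = Vec.[] ∷ []
subsets (suc n) = map (true Vec.∷_) (subsets n) ++ map (false Vec.∷_) (subsets n)

degree : Graph n → Fin n → ℕ
degree G v = ∣ comprehension (adj? G v) ∣

-- The bottom value 0 only matters for the graph with no vertices.
Δ : Graph n → ℕ
Δ {n} G = max 0 (map (degree G) (allFin n))

data Walk (G : Graph n) : Fin n → Fin n → ℕ → Set where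
  nil  : ∀ {u} → Walk G u u 0
  cons : ∀ {u v w k} → Adj G u v → Walk G v w k → Walk G u w (suc k)

Distance : Graph n → Fin n → Fin n → ℕ → Set
Distance G u v d = Walk G u v d × (∀ {k} → Walk G u v k → d ≤ k)

CommonNeighbour : Graph n → Fin n → Fin n → Set
CommonNeighbour G u v = u ≢ v × ¬ Adj G u v × ∃[ w ] (Adj G u w × Adj G w v)

toDistance2 : (G : Graph n) → ∀ {u v} → CommonNeighbour G u v → Distance G u v 2
toDistance2 G {u} {v} (u≢v , ¬uv , w , uw , wv) = cons uw (cons wv nil) , shortest
  where
  shortest : ∀ {k} → Walk G u v k → 2 ≤ k
  shortest nil                   = contradiction refl u≢v
  shortest (cons uv nil)         = contradiction uv ¬uv
  shortest (cons _ (cons _ _))   = s≤s (s≤s z≤n)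

fromDistance2 : (G : Graph n) → ∀ {u v} → Distance G u v 2 → CommonNeighbour G u v
fromDistance2 G (cons {v = w} uw (cons wv nil) , shortest) =
  (λ { refl → contradiction (shortest nil) λ () }) ,
  (λ uv → contradiction (shortest (cons uv nil)) λ { (s≤s ()) }) ,
  w , uw , wv

distance2? : (G : Graph n) → Decidable (λ u v → Distance G u v 2)
distance2? G u v = map′ (toDistance2 G) (fromDistance2 G)
  (¬? (u ≟ v) ×-dec ¬? (adj? G u v) ×-dec any? (λ w → adj? G u w ×-dec adj? G w v))

distance2-sym : (G : Graph n) → Symmetric (λ u v → Distance G u v 2)
distance2-sym G d with fromDistance2 G d
... | u≢v , ¬uv , w , uw , wv =
  toDistance2 G (≢-sym u≢v , (λ vu → ¬uv (symm G vu)) , w , symm G wv , symm G uw)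

infix 9 _²

_² : Graph n → Graph n
Adj    (G ²) u v = Adj G u v ⊎ Distance G u v 2
adj?   (G ²) u v = adj? G u v ⊎-dec distance2? G u v
symm   (G ²) (inj₁ uv) = inj₁ (symm G uv)
symm   (G ²) (inj₂ d)  = inj₂ (distance2-sym G d)
irrefl (G ²) u≡v (inj₁ uv) = irrefl G u≡v uv
irrefl (G ²) refl (inj₂ (_ , shortest)) with shortest nil
... | ()

Clique : Graph n → Subset n → Set
Clique G S = ∀ u v → u ∈ S → v ∈ S → u ≢ v → Adj G u v

clique? : (G : Graph n) → U.Decidable (Clique G)
clique? G S = all? λ u → all? λ v →
  (u ∈? S) →-dec ((v ∈? S) →-dec (¬? (u ≟ v) →-dec adj? G u v))

Independent : Graph n → Subset n → Set
Independent G S = ∀ u v → u ∈ S → v ∈ S → ¬ Adj G u v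

-- The empty set is always a clique, so the maximum is over a nonempty list.
ω : Graph n → ℕ
ω {n} G = max 0 (map ∣_∣ (filter (clique? G) (subsets n)))

MaximumClique : Graph n → Subset n → Set
MaximumClique G S = Clique G S × (∀ T → Clique G T → ∣ T ∣ ≤ ∣ S ∣)

-- A vertex ordering is a permutation π, with π ⟨$⟩ʳ v the position of v.
laterNeighbours : Graph n → Permutation′ n → Fin n → Subset n
laterNeighbours G π v =
  comprehension (λ w → adj? G v w ×-dec ((π ⟨$⟩ʳ v) <? (π ⟨$⟩ʳ w)))

DegeneracyOrder : ℕ → Graph n → Permutation′ n → Set
DegeneracyOrder k G π = ∀ v → ∣ laterNeighbours G π v ∣ ≤ k

Consecutive : Permutation′ n → Subset n → Set
Consecutive π S = ∀ u v w → u ∈ S → w ∈ S →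
  π ⟨$⟩ʳ u ≤ᶠ π ⟨$⟩ʳ v → π ⟨$⟩ʳ v ≤ᶠ π ⟨$⟩ʳ w → v ∈ S

Nice : Graph n → Subset n → Set
Nice G S = Clique (G ²) S
         × Independent G S
         × ∃[ π ] (DegeneracyOrder 2 G π × Consecutive π S)

{-# OPTIONS --safe #-}

-- View each vertex of S as an edge joining its (at most two) later neighbours; since S is
-- consecutive and independent, those lie after S.  In this multigraph every degree is at most D.
-- Vertices of S with disjoint edges have a common neighbour before S, and such a vertex has at most
-- two neighbours in S, so each edge is disjoint from at most D others.  Hence an edge xy of
-- multiplicity μ gives |S| + μ ≤ D + d(x) + d(y).  Summing over the neighbours of a vertex x of
-- minimum positive degree, and bounding the remaining degrees by d(x) below and D above, yields
-- 2|S| ≤ 5D.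
module Submission where

open import Defs
open import Data.Bool.Base using (if_then_else_; true; false)
open import Data.Fin.Base using (Fin; zero; suc) renaming (_<_ to _<ᶠ_)
open import Data.Fin.Permutation using (Permutation′; _⟨$⟩ʳ_)
open import Data.Fin.Properties using (any?; _≟_) renaming (_<?_ to _<ᶠ?_)
open import Data.Fin.Subset using (Subset; _∈_; ∣_∣)
open import Data.Fin.Subset.Properties using (_∈?_)
open import Data.Integer.Base as ℤ using (+_; +≤+)
import Data.Integer.Properties as ℤₚ
open import Data.List.Base using (allFin; map)
open import Data.List.Extrema.Nat using (max≤v⁺; xs≤max)
import Data.List.Membership.Propositional.Properties as ∈ₚ
import Data.List.Relation.Unary.All as All
import Data.List.Relation.Unary.All.Properties as Allₚ
open import Data.Nat.Base
  using (ℕ; zero; suc; _+_; _*_; _≤_; _<_; _>_; z≤n; s≤s; compare; less; equal; greater)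
open import Data.Nat.Induction using (Acc; acc; <-wellFounded)
open import Data.Nat.Properties hiding (_≟_)
open import Data.Nat.Tactic.RingSolver using (solve-∀)
open import Data.Product.Base using (∃; ∃-syntax; _×_; _,_; proj₁; proj₂)
open import Data.Rational.Base as ℚ using (_/_)
import Data.Rational.Properties as ℚₚ
open import Data.Rational.Unnormalised.Base as ℚᵘ using (mkℚᵘ; *≤*)
import Data.Rational.Unnormalised.Properties as ℚᵘₚ
open import Data.Sum.Base using (_⊎_; inj₁; inj₂)
open import Data.Vec.Base using ([]; _∷_)
open import Function.Base using (_∘_)
open import Level using (0ℓ)
open import Relation.Binary.Core using (REL)
open import Relation.Binary.Definitions using (Decidable)
open import Relation.Binary.PropositionalEquality
open import Relation.Nullary using (¬_; Dec; yes; no; does; contradiction)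
open import Relation.Nullary.Decidable using (¬?; _×-dec_)
import Relation.Unary as U

open import Algebra.Properties.Semiring.Sum +-*-semiring
  using (∑-distrib-+; ∑-comm; *-distribˡ-sum; *-distribʳ-sum; sum-cong-≗; sum-replicate-zero; sum-syntax)

open Graph

private
  variable
    n p q : ℕ

-- Arithmetic

-- Linear arithmetic by certificate: `a ≤ b` is a nonnegative combination of known inequalities and
-- `s` is the slack. What remains is a polynomial identity, written without subtraction so that the
-- ring solver can check it.
≤-by-certificate : ∀ {a b} u v s → a ≤ b → u + b + s ≡ v + a → u ≤ v
≤-by-certificate {a} {b} u v s a≤b eq = +-cancelʳ-≤ b u v (begin
  u + b      ≤⟨ m≤m+n (u + b) s ⟩
  u + b + s  ≡⟨ eq ⟩
  v + a      ≤⟨ +-monoʳ-≤ v a≤b ⟩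
  v + b      ∎)
  where open ≤-Reasoning

m≤D+D⇒2m≤5D : ∀ m D → m ≤ D + D → 2 * m ≤ 5 * D
m≤D+D⇒2m≤5D m D m≤2D =
  ≤-by-certificate (2 * m) (5 * D) D (*-monoʳ-≤ 2 m≤2D) (identity m D)
  where
  identity : ∀ m D → 2 * m + 2 * (D + D) + D ≡ 5 * D + 2 * m
  identity = solve-∀

-- δ is the minimum positive degree, attained at x; k and r count the neighbours of x and the other
-- non-isolated vertices; dN and dR are the respective sums of degrees.
record NeighbourhoodBounds (D m δ k r dN dR : ℕ) : Set where
  field
    edges      : k * m + δ ≤ k * D + k * δ + dN
    handshake  : 2 * m ≡ δ + dN + dR
    δ≤D        : δ ≤ D
    kδ≤dN      : k * δ ≤ dN
    dN≤kD      : dN ≤ k * D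
    rδ≤dR      : r * δ ≤ dR
    dR≤rD      : dR ≤ r * D

module _ {D m δ dN dR : ℕ} where
  open NeighbourhoodBounds

  -- On at most five non-isolated vertices the degree sum alone suffices, since each degree is at
  -- most D. This settles the small cases that the certificates below miss.
  few-vertices : ∀ {k r} → 1 + k + r ≤ 5 → NeighbourhoodBounds D m δ k r dN dR → 2 * m ≤ 5 * D
  few-vertices {k} {r} le h = begin
    2 * m              ≡⟨ handshake h ⟩
    δ + dN + dR        ≤⟨ +-mono-≤ (+-mono-≤ (δ≤D h) (dN≤kD h)) (dR≤rD h) ⟩
    D + k * D + r * D  ≡⟨ identity D k r ⟩
    (1 + k + r) * D    ≤⟨ *-monoˡ-≤ D le ⟩
    5 * D              ∎
    where
    open ≤-Reasoning
    identity : ∀ D k r → D + k * D + r * D ≡ (1 + k + r) * D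
    identity = solve-∀

  -- For k = 1 the term δ cancels in `edges`, so m ≤ D + dN ≤ 2D.
  one-neighbour : ∀ {r} → NeighbourhoodBounds D m δ 1 r dN dR → 2 * m ≤ 5 * D
  one-neighbour h = ≤-by-certificate (2 * m) (5 * D) D
    (+-mono-≤ (*-monoʳ-≤ 2 (edges h)) (*-monoʳ-≤ 2 (dN≤kD h))) (identity D m δ dN)
    where
    identity : ∀ D m δ dN → 2 * m + (2 * (1 * D + 1 * δ + dN) + 2 * (1 * D)) + D
                          ≡ 5 * D + (2 * (1 * m + δ) + 2 * dN)
    identity = solve-∀

  -- For k = 2, `edges` gives 2m ≤ 2D + δ + dN, and the last two terms are at most D and 2D.
  two-neighbours : ∀ {r} → NeighbourhoodBounds D m δ 2 r dN dR → 2 * m ≤ 5 * D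
  two-neighbours h = ≤-by-certificate (2 * m) (5 * D) 0
    (+-mono-≤ (edges h) (+-mono-≤ (dN≤kD h) (δ≤D h))) (identity D m δ dN)
    where
    identity : ∀ D m δ dN → 2 * m + ((2 * D + 2 * δ + dN) + (2 * D + D)) + 0
                          ≡ 5 * D + ((2 * m + δ) + (dN + δ))
    identity = solve-∀

  -- Eliminating dN and dR gives (k-2)m + (r+2-k)δ ≤ kD; here r + 2 - k = b ≥ 0, and δ is bounded
  -- below through km + δ ≤ 2kD + kδ.
  module _ (a b : ℕ) (h : NeighbourhoodBounds D m δ (3 + a) (1 + a + b) dN dR) where

    private
      -- With k = 3 + a, the weight 2(k-1) goes to the elimination of dN and dR and the weight 2b to
      -- the lower bound on δ. These weights make δ cancel; `edges` enters both parts.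
      combination :
        (2 * (2 + a) + 2 * b) * ((3 + a) * m + δ) + 2 * (2 + a) * ((1 + a + b) * δ)
          + 2 * (2 + a) * (δ + dN + dR) + 2 * b * dN
        ≤ (2 * (2 + a) + 2 * b) * ((3 + a) * D + (3 + a) * δ + dN) + 2 * (2 + a) * dR
          + 2 * (2 + a) * (2 * m) + 2 * b * ((3 + a) * D)
      combination = +-mono-≤ (+-mono-≤ (+-mono-≤
        (*-monoʳ-≤ (2 * (2 + a) + 2 * b) (edges h))
        (*-monoʳ-≤ (2 * (2 + a)) (rδ≤dR h)))
        (*-monoʳ-≤ (2 * (2 + a)) (≤-reflexive (sym (handshake h)))))
        (*-monoʳ-≤ (2 * b) (dN≤kD h))

    -- After δ cancels, ((k-1)(k-2) + bk) 2m ≤ 2k(k-1+2b) D. The slack relative to 5D is D times 5a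
    -- + 3a² + 3b + ab - 2, a factor that is negative only for a = b = 0; `s` stands for it without
    -- subtraction.
    many-strangers : ∀ s → s + 2 ≡ 5 * a + 3 * a * a + 3 * b + a * b → 2 * m ≤ 5 * D
    many-strangers s eq = *-cancelˡ-≤ (2 + (3 * a + a * a + b * (3 + a)))
      (≤-by-certificate _ _ (D * s) combination (+-cancelʳ-≡ (D * 2) _ _ (begin
        lhs + D * s + D * 2      ≡⟨ +-assoc lhs (D * s) (D * 2) ⟩
        lhs + (D * s + D * 2)    ≡⟨ cong (_+_ lhs) (*-distribˡ-+ D s 2) ⟨
        lhs + D * (s + 2)        ≡⟨ cong (λ t → lhs + D * t) eq ⟩
        lhs + D * (5 * a + 3 * a * a + 3 * b + a * b) ≡⟨ identity D m δ dN dR a b ⟩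
        _ ∎)))
      where
      open ≡-Reasoning
      lhs = (2 + (3 * a + a * a + b * (3 + a))) * (2 * m)
        + ((2 * (2 + a) + 2 * b) * ((3 + a) * D + (3 + a) * δ + dN) + 2 * (2 + a) * dR
          + 2 * (2 + a) * (2 * m) + 2 * b * ((3 + a) * D))
      identity : ∀ D m δ dN dR a b →
        (2 + (3 * a + a * a + b * (3 + a))) * (2 * m)
        + ((2 * (2 + a) + 2 * b) * ((3 + a) * D + (3 + a) * δ + dN) + 2 * (2 + a) * dR
          + 2 * (2 + a) * (2 * m) + 2 * b * ((3 + a) * D))
        + D * (5 * a + 3 * a * a + 3 * b + a * b)
        ≡ (2 + (3 * a + a * a + b * (3 + a))) * (5 * D)
        + ((2 * (2 + a) + 2 * b) * ((3 + a) * m + δ) + 2 * (2 + a) * ((1 + a + b) * δ)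
          + 2 * (2 + a) * (δ + dN + dR) + 2 * b * dN) + D * 2
      identity = solve-∀

  -- Now r + 2 - k = -(1 + j) < 0, and δ is bounded above through (1+k+r)δ ≤ 2m.
  module _ (r j : ℕ) (h : NeighbourhoodBounds D m δ (3 + r + j) r dN dR) where

    private
      -- With k = 3 + r + j, the weight 2(1+k+r) goes to (k-2)m ≤ kD + (1+j)δ and the weight 2(1+j)
      -- to the upper bound on δ, so that δ cancels.
      combination :
        2 * (4 + 2 * r + j) * ((3 + r + j) * m + δ + r * δ + (δ + dN + dR))
          + 2 * (1 + j) * (δ + (3 + r + j) * δ + r * δ)
        ≤ 2 * (4 + 2 * r + j) * ((3 + r + j) * D + (3 + r + j) * δ + dN + dR + 2 * m)
          + 2 * (1 + j) * (2 * m)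
      combination = +-mono-≤
        (*-monoʳ-≤ (2 * (4 + 2 * r + j))
          (+-mono-≤ (+-mono-≤ (edges h) (rδ≤dR h)) (≤-reflexive (sym (handshake h)))))
        (*-monoʳ-≤ (2 * (1 + j))
          (≤-trans (+-mono-≤ (+-monoʳ-≤ δ (kδ≤dN h)) (rδ≤dR h)) (≤-reflexive (sym (handshake h)))))

    -- Here the slack is D times 10r + j + 6r² + 9rj + 3j² - 14, a factor that is negative only for
    -- r = 0 and j ≤ 1.
    few-strangers : ∀ s → s + 14 ≡ 10 * r + j + 6 * r * r + 9 * r * j + 3 * j * j → 2 * m ≤ 5 * D
    few-strangers s eq = *-cancelˡ-≤ (2 + (6 * r + 3 * j + 2 * r * r + 3 * r * j + j * j))
      (≤-by-certificate _ _ (D * s) combination (+-cancelʳ-≡ (D * 14) _ _ (begin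
        lhs + D * s + D * 14     ≡⟨ +-assoc lhs (D * s) (D * 14) ⟩
        lhs + (D * s + D * 14)   ≡⟨ cong (_+_ lhs) (*-distribˡ-+ D s 14) ⟨
        lhs + D * (s + 14)       ≡⟨ cong (λ t → lhs + D * t) eq ⟩
        lhs + D * (10 * r + j + 6 * r * r + 9 * r * j + 3 * j * j) ≡⟨ identity D m δ dN dR r j ⟩
        _ ∎)))
      where
      open ≡-Reasoning
      lhs = (2 + (6 * r + 3 * j + 2 * r * r + 3 * r * j + j * j)) * (2 * m)
        + (2 * (4 + 2 * r + j) * ((3 + r + j) * D + (3 + r + j) * δ + dN + dR + 2 * m)
          + 2 * (1 + j) * (2 * m))
      identity : ∀ D m δ dN dR r j →
        (2 + (6 * r + 3 * j + 2 * r * r + 3 * r * j + j * j)) * (2 * m)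
        + (2 * (4 + 2 * r + j) * ((3 + r + j) * D + (3 + r + j) * δ + dN + dR + 2 * m)
          + 2 * (1 + j) * (2 * m))
        + D * (10 * r + j + 6 * r * r + 9 * r * j + 3 * j * j)
        ≡ (2 + (6 * r + 3 * j + 2 * r * r + 3 * r * j + j * j)) * (5 * D)
        + (2 * (4 + 2 * r + j) * ((3 + r + j) * m + δ + r * δ + (δ + dN + dR))
          + 2 * (1 + j) * (δ + (3 + r + j) * δ + r * δ)) + D * 14
      identity = solve-∀

  bound-many-strangers : ∀ a b → NeighbourhoodBounds D m δ (3 + a) (1 + a + b) dN dR → 2 * m ≤ 5 * D
  -- The exceptional case k = 3, r = 1 has exactly five non-isolated vertices.
  bound-many-strangers 0       0       h = few-vertices ≤-refl h
  bound-many-strangers 0       (suc b) h = many-strangers 0 (suc b) h (1 + 3 * b) (identity b)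
    where
    identity : ∀ b → 1 + 3 * b + 2 ≡ 3 * suc b + 0
    identity = solve-∀
  bound-many-strangers (suc a) b       h =
    many-strangers (suc a) b h (6 + 11 * a + 3 * a * a + 4 * b + a * b) (identity a b)
    where
    identity : ∀ a b → 6 + 11 * a + 3 * a * a + 4 * b + a * b + 2
      ≡ 5 * suc a + 3 * suc a * suc a + 3 * b + suc a * b
    identity = solve-∀

  bound-few-strangers : ∀ r j → NeighbourhoodBounds D m δ (3 + r + j) r dN dR → 2 * m ≤ 5 * D
  -- The exceptional cases r = 0 with k = 3 or k = 4 have four and five non-isolated vertices.
  bound-few-strangers 0       0             h = few-vertices (m≤m+n 4 1) h
  bound-few-strangers 0       1             h = few-vertices ≤-refl h
  bound-few-strangers 0       (suc (suc j)) h =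
    few-strangers 0 (suc (suc j)) h (13 * j + 3 * j * j) (identity j)
    where
    identity : ∀ j → 13 * j + 3 * j * j + 14 ≡ suc (suc j) + 0 + 0 + 3 * suc (suc j) * suc (suc j)
    identity = solve-∀
  bound-few-strangers (suc r) j             h =
    few-strangers (suc r) j h (2 + 22 * r + 6 * r * r + 10 * j + 9 * r * j + 3 * j * j) (identity r j)
    where
    identity : ∀ r j → 2 + 22 * r + 6 * r * r + 10 * j + 9 * r * j + 3 * j * j + 14
      ≡ 10 * suc r + j + 6 * suc r * suc r + 9 * suc r * j + 3 * j * j
    identity = solve-∀

  neighbourhood-bound : ∀ k r → 0 < δ → NeighbourhoodBounds D m δ k r dN dR → 2 * m ≤ 5 * D
  -- Without neighbours, `edges` reads δ ≤ dN and dN ≤ 0.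
  neighbourhood-bound 0 r 0<δ h = contradiction (≤-trans (edges h) (dN≤kD h)) (<⇒≱ 0<δ)
  neighbourhood-bound 1 r 0<δ h = one-neighbour h
  neighbourhood-bound 2 r 0<δ h = two-neighbours h
  -- With 3 + k neighbours, the coefficient r + 2 - (3 + k) of δ is nonnegative exactly when k < r.
  neighbourhood-bound (suc (suc (suc k))) r 0<δ h with compare k r
  ... | less k b    = bound-many-strangers k b h
  ... | equal r     = bound-few-strangers r 0
    (subst (λ k → NeighbourhoodBounds D m δ (3 + k) r dN dR) (sym (+-identityʳ r)) h)
  ... | greater r j = bound-few-strangers r (suc j)
    (subst (λ k → NeighbourhoodBounds D m δ (3 + k) r dN dR) (sym (+-suc r j)) h)

-- Finite sums and indicators

∑-mono-≤ : {f g : Fin n → ℕ} → (∀ i → f i ≤ g i) → ∑[ i < n ] f i ≤ ∑[ i < n ] g i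
∑-mono-≤ {zero}  f≤g = z≤n
∑-mono-≤ {suc n} f≤g = +-mono-≤ (f≤g zero) (∑-mono-≤ (f≤g ∘ suc))

∑-positive : {f : Fin n → ℕ} → 0 < ∑[ i < n ] f i → ∃[ i ] 0 < f i
∑-positive {suc n} {f} 0<∑ with f zero in eq
... | suc _ = zero , subst (0 <_) (sym eq) (s≤s z≤n)
... | zero  with ∑-positive {n} 0<∑
...   | i , 0<fi = suc i , 0<fi

term≤∑ : ∀ (f : Fin n → ℕ) i → f i ≤ ∑[ j < n ] f j
term≤∑ f zero    = m≤m+n _ _
term≤∑ f (suc i) = m≤n⇒m≤o+n (f zero) (term≤∑ (f ∘ suc) i)

∑-distrib-+₃ : ∀ (f g h : Fin n → ℕ) →
  ∑[ i < n ] (f i + g i + h i) ≡ ∑[ i < n ] f i + ∑[ i < n ] g i + ∑[ i < n ] h i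
∑-distrib-+₃ {n} f g h =
  trans (∑-distrib-+ (λ i → f i + g i) h) (cong (_+ ∑[ i < n ] h i) (∑-distrib-+ f g))

-- The Iverson bracket. With cardinalities written as sums of brackets, counting arguments become
-- pointwise inequalities, and double counting becomes `∑-comm`.
⟦_⟧ : {P : Set} → Dec P → ℕ
⟦ P? ⟧ = if does P? then 1 else 0

⟦⟧-≤ : {P : Set} (P? : Dec P) {k : ℕ} → (P → 1 ≤ k) → ⟦ P? ⟧ ≤ k
⟦⟧-≤ (yes p) 1≤k = 1≤k p
⟦⟧-≤ (no _)  1≤k = z≤n

⟦⟧-yes : {P : Set} (P? : Dec P) → P → ⟦ P? ⟧ ≡ 1
⟦⟧-yes (yes _) p = refl
⟦⟧-yes (no ¬p) p = contradiction p ¬p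

⟦⟧-no : {P : Set} (P? : Dec P) → ¬ P → ⟦ P? ⟧ ≡ 0
⟦⟧-no (yes p) ¬p = contradiction p ¬p
⟦⟧-no (no _)  ¬p = refl

⟦⟧-mono : {P Q : Set} (P? : Dec P) (Q? : Dec Q) → (P → Q) → ⟦ P? ⟧ ≤ ⟦ Q? ⟧
⟦⟧-mono P? Q? p⇒q = ⟦⟧-≤ P? (λ p → ≤-reflexive (sym (⟦⟧-yes Q? (p⇒q p))))

⟦⟧-idem : {P : Set} (P? : Dec P) → ⟦ P? ⟧ * ⟦ P? ⟧ ≡ ⟦ P? ⟧
⟦⟧-idem (yes _) = refl
⟦⟧-idem (no _)  = refl

⟦⟧≤1 : {P : Set} (P? : Dec P) → ⟦ P? ⟧ ≤ 1
⟦⟧≤1 P? = ⟦⟧-≤ P? (λ _ → ≤-refl)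

∑-singleton : ∀ (x : Fin n) → ∑[ y < n ] ⟦ x ≟ y ⟧ ≡ 1
∑-singleton {suc n} zero    = cong suc (sum-replicate-zero n)
∑-singleton {suc n} (suc x) = ∑-singleton x

∣comprehension∣ : {P : U.Pred (Fin n) 0ℓ} (P? : U.Decidable P) →
  ∣ comprehension P? ∣ ≡ ∑[ v < n ] ⟦ P? v ⟧
∣comprehension∣ {zero}  P? = refl
∣comprehension∣ {suc n} P? with P? zero
... | yes _ = cong suc (∣comprehension∣ (P? ∘ suc))
... | no _  = ∣comprehension∣ (P? ∘ suc)

∣∣≡∑ : ∀ (S : Subset n) → ∣ S ∣ ≡ ∑[ v < n ] ⟦ v ∈? S ⟧
∣∣≡∑ []          = refl
∣∣≡∑ (true ∷ S)  = cong suc (∣∣≡∑ S)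
∣∣≡∑ (false ∷ S) = ∣∣≡∑ S

module _ {P : U.Pred (Fin n) 0ℓ} (P? : U.Decidable P) where

  two-elements : ∀ {x y} → x ≢ y → P x → P y → 2 ≤ ∑[ v < n ] ⟦ P? v ⟧
  two-elements {x} {y} x≢y px py = begin
    2                                                ≡⟨ cong₂ _+_ (∑-singleton x) (∑-singleton y) ⟨
    ∑[ v < n ] ⟦ x ≟ v ⟧ + ∑[ v < n ] ⟦ y ≟ v ⟧      ≡⟨ ∑-distrib-+ (λ v → ⟦ x ≟ v ⟧) (λ v → ⟦ y ≟ v ⟧) ⟨
    ∑[ v < n ] (⟦ x ≟ v ⟧ + ⟦ y ≟ v ⟧)               ≤⟨ ∑-mono-≤ pointwise ⟩
    ∑[ v < n ] ⟦ P? v ⟧                              ∎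
    where
    open ≤-Reasoning
    pointwise : ∀ v → ⟦ x ≟ v ⟧ + ⟦ y ≟ v ⟧ ≤ ⟦ P? v ⟧
    pointwise v with x ≟ v | y ≟ v
    ... | yes refl | yes refl = contradiction refl x≢y
    ... | yes refl | no _     = ≤-reflexive (sym (⟦⟧-yes (P? v) px))
    ... | no _     | yes refl = ≤-reflexive (sym (⟦⟧-yes (P? v) py))
    ... | no _     | no _     = z≤n

  ∑-remove-one : ∀ {x} → P x → ∑[ v < n ] ⟦ P? v ×-dec ¬? (v ≟ x) ⟧ + 1 ≤ ∑[ v < n ] ⟦ P? v ⟧
  ∑-remove-one {x} px = begin
    ∑[ v < n ] others v + 1                           ≡⟨ cong (_+_ (∑[ v < n ] others v)) (∑-singleton x) ⟨
    ∑[ v < n ] others v + ∑[ v < n ] ⟦ x ≟ v ⟧        ≡⟨ ∑-distrib-+ others (λ v → ⟦ x ≟ v ⟧) ⟨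
    ∑[ v < n ] (others v + ⟦ x ≟ v ⟧)                 ≤⟨ ∑-mono-≤ pointwise ⟩
    ∑[ v < n ] ⟦ P? v ⟧                               ∎
    where
    open ≤-Reasoning
    others : Fin n → ℕ
    others v = ⟦ P? v ×-dec ¬? (v ≟ x) ⟧
    pointwise : ∀ v → others v + ⟦ x ≟ v ⟧ ≤ ⟦ P? v ⟧
    pointwise v with P? v | v ≟ x | x ≟ v
    ... | _      | yes refl | no x≢x   = contradiction refl x≢x
    ... | _      | no v≢v   | yes refl = contradiction refl v≢v
    ... | no ¬px | _        | yes refl = contradiction px ¬px
    ... | yes _  | yes _    | yes _    = ≤-refl
    ... | yes _  | no _     | no _     = ≤-refl
    ... | no _   | no _     | no _     = z≤n

-- If z were a third element, deleting x would still leave the two elements y and z.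
at-most-two : {P : U.Pred (Fin n) 0ℓ} (P? : U.Decidable P) → ∑[ v < n ] ⟦ P? v ⟧ ≤ 2 →
  ∀ {x y z} → P x → P y → P z → x ≢ y → z ≡ x ⊎ z ≡ y
at-most-two P? ≤2 {x} {y} {z} px py pz x≢y with z ≟ x | z ≟ y
... | yes z≡x | _       = inj₁ z≡x
... | no _    | yes z≡y = inj₂ z≡y
... | no z≢x  | no z≢y  = contradiction (≤-trans (∑-remove-one P? px) ≤2) (<⇒≱ (+-monoˡ-< 1
  (two-elements (λ v → P? v ×-dec ¬? (v ≟ x)) (≢-sym z≢y) (py , ≢-sym x≢y) (pz , z≢x))))

minimiser : {P : U.Pred (Fin n) 0ℓ} → U.Decidable P → ∀ (f : Fin n → ℕ) → ∃ P →
  ∃[ x ] (P x × (∀ y → P y → f x ≤ f y))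
minimiser {P = P} P? f (x , px) = go x px (<-wellFounded (f x))
  where
  go : ∀ x → P x → Acc _<_ (f x) → ∃[ x ] (P x × (∀ y → P y → f x ≤ f y))
  go x px (acc rs) with any? (λ y → P? y ×-dec (f y <? f x))
  ... | yes (y , py , fy<fx) = go y py (rs fy<fx)
  ... | no ¬better           = x , px , λ y py → ≮⇒≥ (λ fy<fx → ¬better (y , py , fy<fx))

-- A loopless multigraph with m edges, given by its degrees d and multiplicities μ.  With the
-- diagonal convention μ x x = d x, each edge at x is counted twice in ∑ μ x.
module _ (D m : ℕ) (d : Fin n → ℕ) (μ : Fin n → Fin n → ℕ)
  (d≤D       : ∀ x → d x ≤ D)
  (diagonal  : ∀ x → μ x x ≡ d x)
  (μ≤d       : ∀ x y → μ x y ≤ d y)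
  (∑μ        : ∀ x → ∑[ y < n ] μ x y ≡ 2 * d x)
  (∑d        : ∑[ y < n ] d y ≡ 2 * m)
  (edge-bound : ∀ x y → x ≢ y → 0 < μ x y → m + μ x y ≤ D + d x + d y)
  where

  private
    module Neighbourhood (x : Fin n) (0<dx : 0 < d x) (dx-min : ∀ y → 0 < d y → d x ≤ d y) where

      -- Indicators of x, of its neighbours and of the other non-isolated vertices. Isolated
      -- vertices lie in none of the three classes: they add nothing to the degree sum, and `d x` is
      -- minimal only among positive degrees.
      self near far : Fin n → ℕ
      self y = ⟦ x ≟ y ⟧
      near y = ⟦ ¬? (x ≟ y) ×-dec (0 <? μ x y) ⟧
      far  y = ⟦ ¬? (x ≟ y) ×-dec (¬? (0 <? μ x y) ×-dec (0 <? d y)) ⟧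

      ∑self : ∑[ y < n ] (self y * d x) ≡ d x
      ∑self = begin
        ∑[ y < n ] (self y * d x)  ≡⟨ *-distribʳ-sum (d x) self ⟨
        ∑[ y < n ] self y * d x    ≡⟨ cong (_* d x) (∑-singleton x) ⟩
        1 * d x                    ≡⟨ *-identityˡ (d x) ⟩
        d x                        ∎
        where open ≡-Reasoning

      split-d : ∀ y → d y ≡ self y * d x + near y * d y + far y * d y
      split-d y with x ≟ y
      ... | yes refl = sym (trans (+-identityʳ _) (trans (+-identityʳ _) (*-identityˡ (d x))))
      ... | no _ with μ x y
      ...   | suc _ = sym (trans (+-identityʳ _) (*-identityˡ (d y)))
      ...   | zero with d y
      ...     | suc d = sym (*-identityˡ (suc d))
      ...     | zero  = refl

      split-μ : ∀ y → μ x y ≡ self y * d x + near y * μ x y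
      split-μ y with x ≟ y
      ... | yes refl = trans (diagonal x) (sym (trans (+-identityʳ _) (*-identityˡ (d x))))
      ... | no _ with μ x y
      ...   | suc μ = sym (*-identityˡ (suc μ))
      ...   | zero  = refl

      k r dN dR : ℕ
      k  = ∑[ y < n ] near y
      r  = ∑[ y < n ] far y
      dN = ∑[ y < n ] (near y * d y)
      dR = ∑[ y < n ] (far y * d y)

      -- The diagonal entry accounts for one of the two copies of `d x` in `∑μ`; the other counts
      -- the edges at x by their second end.
      near-μ : ∑[ y < n ] (near y * μ x y) ≡ d x
      near-μ = +-cancelˡ-≡ (d x) _ _ (begin
        d x + ∑[ y < n ] (near y * μ x y)
          ≡⟨ cong (_+ ∑[ y < n ] (near y * μ x y)) ∑self ⟨
        ∑[ y < n ] (self y * d x) + ∑[ y < n ] (near y * μ x y)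
          ≡⟨ ∑-distrib-+ (λ y → self y * d x) (λ y → near y * μ x y) ⟨
        ∑[ y < n ] (self y * d x + near y * μ x y)
          ≡⟨ sum-cong-≗ split-μ ⟨
        ∑[ y < n ] μ x y
          ≡⟨ ∑μ x ⟩
        2 * d x
          ≡⟨ cong (_+_ (d x)) (+-identityʳ (d x)) ⟩
        d x + d x ∎)
        where open ≡-Reasoning

      edge-bound-near : ∀ y → near y * m + near y * μ x y ≤ near y * D + near y * d x + near y * d y
      edge-bound-near y with x ≟ y
      ... | yes _ = z≤n
      ... | no x≢y with μ x y | edge-bound x y x≢y
      ...   | zero  | _     = z≤n
      ...   | suc μ | bound = subst₂ _≤_
        (sym (cong₂ _+_ (*-identityˡ m) (*-identityˡ (suc μ))))
        (sym (cong₂ _+_ (cong₂ _+_ (*-identityˡ D) (*-identityˡ (d x))) (*-identityˡ (d y))))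
        (bound (s≤s z≤n))

      near-min : ∀ y → near y * d x ≤ near y * d y
      near-min y with x ≟ y
      ... | yes _ = z≤n
      ... | no _ with μ x y | μ≤d x y
      ...   | zero  | _    = z≤n
      ...   | suc _ | μ≤dy = *-monoʳ-≤ 1 (dx-min y (≤-trans (s≤s z≤n) μ≤dy))

      far-min : ∀ y → far y * d x ≤ far y * d y
      far-min y with x ≟ y
      ... | yes _ = z≤n
      ... | no _ with μ x y
      ...   | suc _ = z≤n
      ...   | zero with d y | dx-min y
      ...     | zero  | _    = z≤n
      ...     | suc _ | dx≤d = *-monoʳ-≤ 1 (dx≤d (s≤s z≤n))

      bounds : NeighbourhoodBounds D m (d x) k r dN dR
      bounds = record
        -- The edge bound is summed over the neighbours of x; the multiplicities add up to `d x` by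
        -- `near-μ`.
        { edges = begin
            k * m + d x
              ≡⟨ cong₂ _+_ (*-distribʳ-sum m near) (sym near-μ) ⟩
            ∑[ y < n ] (near y * m) + ∑[ y < n ] (near y * μ x y)
              ≡⟨ ∑-distrib-+ (λ y → near y * m) (λ y → near y * μ x y) ⟨
            ∑[ y < n ] (near y * m + near y * μ x y)
              ≤⟨ ∑-mono-≤ edge-bound-near ⟩
            ∑[ y < n ] (near y * D + near y * d x + near y * d y)
              ≡⟨ ∑-distrib-+₃ (λ y → near y * D) (λ y → near y * d x) (λ y → near y * d y) ⟩
            ∑[ y < n ] (near y * D) + ∑[ y < n ] (near y * d x) + dN
              ≡⟨ cong (_+ dN) (cong₂ _+_ (*-distribʳ-sum D near) (*-distribʳ-sum (d x) near)) ⟨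
            k * D + k * d x + dN ∎
        ; handshake = handshake
        ; δ≤D = d≤D x
        ; kδ≤dN = ≤-trans (≤-reflexive (*-distribʳ-sum (d x) near)) (∑-mono-≤ near-min)
        ; dN≤kD = ≤-trans (∑-mono-≤ (λ y → *-monoʳ-≤ (near y) (d≤D y)))
                          (≤-reflexive (sym (*-distribʳ-sum D near)))
        ; rδ≤dR = ≤-trans (≤-reflexive (*-distribʳ-sum (d x) far)) (∑-mono-≤ far-min)
        ; dR≤rD = ≤-trans (∑-mono-≤ (λ y → *-monoʳ-≤ (far y) (d≤D y)))
                          (≤-reflexive (sym (*-distribʳ-sum D far)))
        }
        where
        open ≤-Reasoning
        handshake : 2 * m ≡ d x + dN + dR
        handshake = trans (sym ∑d) (trans (sum-cong-≗ split-d)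
          (trans (∑-distrib-+₃ (λ y → self y * d x) (λ y → near y * d y) (λ y → far y * d y))
                 (cong (λ t → t + dN + dR) ∑self)))

  multigraph-bound : 2 * m ≤ 5 * D
  multigraph-bound with any? (λ x → 0 <? d x)
  ... | no isolated = begin
    2 * m             ≡⟨ ∑d ⟨
    ∑[ y < n ] d y    ≤⟨ ∑-mono-≤ (λ y → ≮⇒≥ (λ 0<dy → isolated (y , 0<dy))) ⟩
    ∑[ y < n ] 0      ≡⟨ sum-replicate-zero n ⟩
    0                 ≤⟨ z≤n ⟩
    5 * D             ∎
    where open ≤-Reasoning
  ... | yes nonisolated with minimiser (λ x → 0 <? d x) d nonisolated
  ...   | x , 0<dx , dx-min = neighbourhood-bound k r 0<dx bounds
    where open Neighbourhood x 0<dx dx-min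

-- Families of edges with at most two ends, where `Inc v y` makes y an end of the edge v

module _ {S : U.Pred (Fin p) 0ℓ} (S? : U.Decidable S)
         {Inc : REL (Fin p) (Fin q) 0ℓ} (Inc? : Decidable Inc) where

  Disjoint : Fin p → U.Pred (Fin p) 0ℓ
  Disjoint v u = S u × u ≢ v × ¬ (∃[ y ] (Inc v y × Inc u y))

  disjoint? : ∀ v → U.Decidable (Disjoint v)
  disjoint? v u = S? u ×-dec (¬? (u ≟ v) ×-dec ¬? (any? λ y → Inc? v y ×-dec Inc? u y))

  module _ (D : ℕ) (0<D : 0 < D)
    (incS       : ∀ {v y} → Inc v y → S v)
    (degree≤D   : ∀ y → ∑[ v < p ] ⟦ Inc? v y ⟧ ≤ D)
    (size≤2     : ∀ v → ∑[ y < q ] ⟦ Inc? v y ⟧ ≤ 2)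
    (disjoint≤D : ∀ v → S v → ∑[ u < p ] ⟦ disjoint? v u ⟧ ≤ D)
    where

    private
      m : ℕ
      m = ∑[ v < p ] ⟦ S? v ⟧

      inc : Fin p → Fin q → ℕ
      inc v y = ⟦ Inc? v y ⟧

      d : Fin q → ℕ
      d y = ∑[ v < p ] inc v y

      μ : Fin q → Fin q → ℕ
      μ x y = ∑[ v < p ] (inc v x * inc v y)

      -- Every other edge is disjoint from an edge without ends, so m ≤ 1 + D ≤ 2D; the last step
      -- uses D > 0.
      empty-edge : ∀ {v} → S v → ¬ (∃[ y ] Inc v y) → 2 * m ≤ 5 * D
      empty-edge {v} sv ¬inc = m≤D+D⇒2m≤5D m D (≤-trans m≤1+D (+-monoˡ-≤ D 0<D))
        where
        open ≤-Reasoning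
        pointwise : ∀ u → ⟦ S? u ⟧ ≤ ⟦ v ≟ u ⟧ + ⟦ disjoint? v u ⟧
        pointwise u with v ≟ u
        ... | yes _  = m≤n⇒m≤n+o _ (⟦⟧≤1 (S? u))
        ... | no v≢u = ⟦⟧-mono (S? u) (disjoint? v u)
          (λ su → su , ≢-sym v≢u , λ (y , vy , _) → ¬inc (y , vy))
        m≤1+D : m ≤ 1 + D
        m≤1+D = begin
          m ≤⟨ ∑-mono-≤ pointwise ⟩
          ∑[ u < p ] (⟦ v ≟ u ⟧ + ⟦ disjoint? v u ⟧)
            ≡⟨ ∑-distrib-+ (λ u → ⟦ v ≟ u ⟧) (λ u → ⟦ disjoint? v u ⟧) ⟩
          ∑[ u < p ] ⟦ v ≟ u ⟧ + ∑[ u < p ] ⟦ disjoint? v u ⟧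
            ≤⟨ +-mono-≤ (≤-reflexive (∑-singleton v)) (disjoint≤D v sv) ⟩
          1 + D ∎

      -- Inclusion-exclusion: an edge of S that avoids both x and y is disjoint from v, and the
      -- edges through both are counted twice in `d x + d y`. The case x = y is allowed and serves
      -- edges with a single end.
      edge-inequality : ∀ {v x y} → Inc v x → Inc v y → (∀ {z} → Inc v z → z ≡ x ⊎ z ≡ y) →
        m + μ x y ≤ D + d x + d y
      edge-inequality {v} {x} {y} vx vy only = begin
        m + μ x y
          ≡⟨ ∑-distrib-+ (λ u → ⟦ S? u ⟧) (λ u → inc u x * inc u y) ⟨
        ∑[ u < p ] (⟦ S? u ⟧ + inc u x * inc u y)
          ≤⟨ ∑-mono-≤ pointwise ⟩
        ∑[ u < p ] (⟦ disjoint? v u ⟧ + inc u x + inc u y)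
          ≡⟨ ∑-distrib-+₃ (λ u → ⟦ disjoint? v u ⟧) (λ u → inc u x) (λ u → inc u y) ⟩
        ∑[ u < p ] ⟦ disjoint? v u ⟧ + d x + d y
          ≤⟨ +-monoˡ-≤ (d y) (+-monoˡ-≤ (d x) (disjoint≤D v (incS vx))) ⟩
        D + d x + d y ∎
        where
        open ≤-Reasoning
        missed : ∀ {u} → ¬ Inc u x → ¬ Inc u y → S u → Disjoint v u
        missed ¬ux ¬uy su = su , (λ { refl → ¬ux vx }) , ¬common
          where
          ¬common : ¬ (∃[ z ] (Inc v z × Inc _ z))
          ¬common (z , vz , uz) with only vz
          ... | inj₁ refl = ¬ux uz
          ... | inj₂ refl = ¬uy uz
        pointwise : ∀ u → ⟦ S? u ⟧ + inc u x * inc u y ≤ ⟦ disjoint? v u ⟧ + inc u x + inc u y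
        pointwise u with Inc? u x | Inc? u y
        ... | yes _  | yes _  = +-monoˡ-≤ 1 (m≤n⇒m≤o+n ⟦ disjoint? v u ⟧ (⟦⟧≤1 (S? u)))
        ... | yes _  | no _   = +-monoˡ-≤ 0 (m≤n⇒m≤o+n ⟦ disjoint? v u ⟧ (⟦⟧≤1 (S? u)))
        ... | no _   | yes _  = subst (_≤ ⟦ disjoint? v u ⟧ + 0 + 1) (sym (+-identityʳ ⟦ S? u ⟧))
                                  (m≤n⇒m≤o+n (⟦ disjoint? v u ⟧ + 0) (⟦⟧≤1 (S? u)))
        ... | no ¬ux | no ¬uy = +-monoˡ-≤ 0 (≤-trans
                                  (⟦⟧-mono (S? u) (disjoint? v u) (missed ¬ux ¬uy))
                                  (m≤m+n _ 0))

      diagonal : ∀ x → μ x x ≡ d x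
      diagonal x = sum-cong-≗ (λ v → ⟦⟧-idem (Inc? v x))

      -- Taking x = y, `μ x x` equals `d x` and cancels one of the two degrees, so m ≤ D + d x ≤ 2D.
      loop : ∀ {v x} → Inc v x → (∀ {z} → Inc v z → z ≡ x) → 2 * m ≤ 5 * D
      loop {v} {x} vx only = m≤D+D⇒2m≤5D m D (≤-trans m≤D+d (+-monoʳ-≤ D (degree≤D x)))
        where
        m≤D+d : m ≤ D + d x
        m≤D+d = +-cancelʳ-≤ (d x) m (D + d x)
          (subst (λ t → m + t ≤ D + d x + d x) (diagonal x) (edge-inequality vx vx (inj₁ ∘ only)))

    edge-count-bound : 2 * m ≤ 5 * D
    -- If the bound fails, `empty-edge` and `loop` force every edge to have exactly two ends, so the
    -- family is a loopless multigraph.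
    edge-count-bound with 2 * m ≤? 5 * D
    ... | yes le = le
    ... | no ¬le = multigraph-bound D m d μ degree≤D diagonal μ≤d ∑μ ∑d edge-bound
      where
      two-ends : ∀ {v} → S v → ∃[ x ] ∃[ y ] (x ≢ y × Inc v x × Inc v y)
      two-ends {v} sv with any? (Inc? v)
      ... | no ¬inc = contradiction (empty-edge sv ¬inc) ¬le
      ... | yes (x , vx) with any? (λ y → ¬? (x ≟ y) ×-dec Inc? v y)
      ...   | yes (y , x≢y , vy) = x , y , x≢y , vx , vy
      ...   | no ¬second = contradiction (loop vx only) ¬le
        where
        only : ∀ {z} → Inc v z → z ≡ x
        only {z} vz with x ≟ z
        ... | yes x≡z = sym x≡z
        ... | no x≢z  = contradiction (z , x≢z , vz) ¬second

      size : ∀ v → ∑[ y < q ] inc v y ≡ 2 * ⟦ S? v ⟧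
      size v with S? v
      ... | no ¬sv = trans (sum-cong-≗ (λ y → ⟦⟧-no (Inc? v y) (¬sv ∘ incS))) (sum-replicate-zero q)
      ... | yes sv with two-ends sv
      ...   | x , y , x≢y , vx , vy = ≤-antisym (size≤2 v) (two-elements (Inc? v) x≢y vx vy)

      size-at : ∀ x v → inc v x * (2 * ⟦ S? v ⟧) ≡ 2 * inc v x
      size-at x v with Inc? v x
      ... | no _   = refl
      ... | yes vx = trans (*-identityˡ _) (cong (2 *_) (⟦⟧-yes (S? v) (incS vx)))

      μ≤d : ∀ x y → μ x y ≤ d y
      μ≤d x y = ∑-mono-≤ (λ v → ≤-trans (*-monoˡ-≤ (inc v y) (⟦⟧≤1 (Inc? v x)))
                                        (≤-reflexive (*-identityˡ (inc v y))))

      ∑μ : ∀ x → ∑[ y < q ] μ x y ≡ 2 * d x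
      ∑μ x = begin
        ∑[ y < q ] ∑[ v < p ] (inc v x * inc v y)  ≡⟨ ∑-comm (λ y v → inc v x * inc v y) ⟩
        ∑[ v < p ] ∑[ y < q ] (inc v x * inc v y)  ≡⟨ sum-cong-≗ (λ v → *-distribˡ-sum (inc v x) (inc v)) ⟨
        ∑[ v < p ] (inc v x * ∑[ y < q ] inc v y)  ≡⟨ sum-cong-≗ (λ v → cong (inc v x *_) (size v)) ⟩
        ∑[ v < p ] (inc v x * (2 * ⟦ S? v ⟧))      ≡⟨ sum-cong-≗ (size-at x) ⟩
        ∑[ v < p ] (2 * inc v x)                   ≡⟨ *-distribˡ-sum 2 (λ v → inc v x) ⟨
        2 * d x                                    ∎
        where open ≡-Reasoning

      ∑d : ∑[ y < q ] d y ≡ 2 * m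
      ∑d = begin
        ∑[ y < q ] ∑[ v < p ] inc v y  ≡⟨ ∑-comm (λ y v → inc v y) ⟩
        ∑[ v < p ] ∑[ y < q ] inc v y  ≡⟨ sum-cong-≗ size ⟩
        ∑[ v < p ] (2 * ⟦ S? v ⟧)      ≡⟨ *-distribˡ-sum 2 (λ v → ⟦ S? v ⟧) ⟨
        2 * m                          ∎
        where open ≡-Reasoning

      edge-bound : ∀ x y → x ≢ y → 0 < μ x y → m + μ x y ≤ D + d x + d y
      edge-bound x y x≢y 0<μ with ∑-positive 0<μ
      -- In the other cases the product of the two brackets is 0, contradicting `0<inc`.
      ... | v , 0<inc with Inc? v x | Inc? v y
      ...   | yes vx | yes vy = edge-inequality vx vy
        (λ vz → at-most-two (Inc? v) (size≤2 v) vx vy vz x≢y)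

-- Niceness and the clique number

degree≤Δ : ∀ (G : Graph n) v → degree G v ≤ Δ G
degree≤Δ {n} G v = All.lookup (xs≤max 0 (map (degree G) (allFin n)))
  (∈ₚ.∈-map⁺ (degree G) (∈ₚ.∈-allFin v))

maximumClique⇒ω≤ : ∀ (G : Graph n) {S} → MaximumClique G S → ω G ≤ ∣ S ∣
maximumClique⇒ω≤ {n} G (_ , largest) =
  max≤v⁺ z≤n (Allₚ.map⁺ (All.map (λ {T} → largest T) (Allₚ.all-filter (clique? G) (subsets n))))

module _ (G : Graph n) (S : Subset n) (π : Permutation′ n)
  (clique      : Clique (G ²) S)
  (independent : Independent G S)
  (degenerate  : DegeneracyOrder 2 G π)
  (consecutive : Consecutive π S)
  where

  private
    Before : Fin n → Fin n → Set
    Before u v = π ⟨$⟩ʳ u <ᶠ π ⟨$⟩ʳ v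

    Later : Fin n → Fin n → Set
    Later v w = Adj G v w × Before v w

    later? : Decidable Later
    later? v w = adj? G v w ×-dec ((π ⟨$⟩ʳ v) <ᶠ? (π ⟨$⟩ʳ w))

    Inc : Fin n → Fin n → Set
    Inc v y = v ∈ S × Later v y

    inc? : Decidable Inc
    inc? v y = (v ∈? S) ×-dec later? v y

    later-count : ∀ v → ∑[ w < n ] ⟦ later? v w ⟧ ≤ 2
    later-count v = subst (_≤ 2) (∣comprehension∣ (later? v)) (degenerate v)

    degree-sum : ∀ v → ∑[ w < n ] ⟦ adj? G v w ⟧ ≤ Δ G
    degree-sum v = subst (_≤ Δ G) (∣comprehension∣ (adj? G v)) (degree≤Δ G v)

    neighbour∉S : ∀ {v w} → v ∈ S → Adj G v w → ¬ w ∈ S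
    neighbour∉S v∈S vw w∈S = independent _ _ v∈S w∈S vw

    -- A neighbour of S lies outside the interval S, so it is on the same side of all of S.
    earlier-neighbour : ∀ {u v w} → u ∈ S → v ∈ S → Adj G v w → ¬ Before v w → Before w u
    earlier-neighbour u∈S v∈S vw ¬v<w =
      ≰⇒> (λ u≤w → neighbour∉S v∈S vw (consecutive _ _ _ u∈S v∈S u≤w (≮⇒≥ ¬v<w)))

    -- As S is independent, v and u are at distance 2 and have a common neighbour w. If w came after
    -- both, it would be a common end; so it precedes one of them, and hence all of S.
    disjoint⇒earlier : ∀ {v u} → v ∈ S → Disjoint (_∈? S) inc? v u →
      ∃[ w ] (Adj G v w × Later w v × Later w u)
    disjoint⇒earlier {v} {u} v∈S (u∈S , u≢v , ¬common) with clique v u v∈S u∈S (≢-sym u≢v)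
    ... | inj₁ vu = contradiction vu (independent v u v∈S u∈S)
    ... | inj₂ d2 with fromDistance2 G d2
    ...   | _ , _ , w , vw , wu with (π ⟨$⟩ʳ v) <ᶠ? (π ⟨$⟩ʳ w) | (π ⟨$⟩ʳ u) <ᶠ? (π ⟨$⟩ʳ w)
    ...     | yes v<w | yes u<w =
      contradiction (w , (v∈S , vw , v<w) , (u∈S , symm G wu , u<w)) ¬common
    ...     | no ¬v<w | _       =
      w , vw , (symm G vw , earlier-neighbour v∈S v∈S vw ¬v<w)
             , (wu , earlier-neighbour u∈S v∈S vw ¬v<w)
    ...     | yes _   | no ¬u<w =
      w , vw , (symm G vw , earlier-neighbour v∈S u∈S (symm G wu) ¬u<w)
             , (wu , earlier-neighbour u∈S u∈S (symm G wu) ¬u<w)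

    -- Each edge u disjoint from v is charged to a common earlier neighbour w. Such a w has at most
    -- two later neighbours, one of which is v, so it is charged at most once; and w ranges over
    -- neighbours of v.
    disjoint-count : ∀ v → v ∈ S → ∑[ u < n ] ⟦ disjoint? (_∈? S) inc? v u ⟧ ≤ Δ G
    disjoint-count v v∈S = begin
      ∑[ u < n ] ⟦ disjoint? (_∈? S) inc? v u ⟧  ≤⟨ ∑-mono-≤ via-earlier ⟩
      ∑[ u < n ] ∑[ w < n ] ⟦ via? w u ⟧         ≡⟨ ∑-comm (λ u w → ⟦ via? w u ⟧) ⟩
      ∑[ w < n ] ∑[ u < n ] ⟦ via? w u ⟧         ≤⟨ ∑-mono-≤ one-each ⟩
      ∑[ w < n ] ⟦ adj? G v w ⟧                  ≤⟨ degree-sum v ⟩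
      Δ G                                        ∎
      where
      open ≤-Reasoning
      Via : Fin n → Fin n → Set
      Via w u = (Adj G v w × Later w v) × (Later w u × u ≢ v)
      via? : Decidable Via
      via? w u = (adj? G v w ×-dec later? w v) ×-dec (later? w u ×-dec ¬? (u ≟ v))
      via-earlier : ∀ u → ⟦ disjoint? (_∈? S) inc? v u ⟧ ≤ ∑[ w < n ] ⟦ via? w u ⟧
      via-earlier u = ⟦⟧-≤ (disjoint? (_∈? S) inc? v u) λ disjoint →
        let w , vw , wv , wu = disjoint⇒earlier v∈S disjoint in ≤-trans
        (≤-reflexive (sym (⟦⟧-yes (via? w u) ((vw , wv) , (wu , proj₁ (proj₂ disjoint))))))
        (term≤∑ (λ w → ⟦ via? w u ⟧) w)
      one-each : ∀ w → ∑[ u < n ] ⟦ via? w u ⟧ ≤ ⟦ adj? G v w ⟧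
      one-each w with any? (via? w)
      ... | no ¬via = begin
        ∑[ u < n ] ⟦ via? w u ⟧
          ≡⟨ sum-cong-≗ (λ u → ⟦⟧-no (via? w u) (λ via → ¬via (u , via))) ⟩
        ∑[ u < n ] 0
          ≡⟨ sum-replicate-zero n ⟩
        0
          ≤⟨ z≤n ⟩
        ⟦ adj? G v w ⟧ ∎
      ... | yes (_ , (vw , wv) , _) = begin
        ∑[ u < n ] ⟦ via? w u ⟧
          ≤⟨ ∑-mono-≤ (λ u → ⟦⟧-mono (via? w u) (later? w u ×-dec ¬? (u ≟ v)) proj₂) ⟩
        ∑[ u < n ] ⟦ later? w u ×-dec ¬? (u ≟ v) ⟧
          ≤⟨ +-cancelʳ-≤ 1 _ 1 (≤-trans (∑-remove-one (later? w) wv) (later-count w)) ⟩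
        1
          ≡⟨ ⟦⟧-yes (adj? G v w) vw ⟨
        ⟦ adj? G v w ⟧ ∎

  nice⇒2∣S∣≤5D : ∀ {D} → 0 < D → Δ G ≤ D → 2 * ∣ S ∣ ≤ 5 * D
  nice⇒2∣S∣≤5D {D} 0<D Δ≤D = subst (λ m → 2 * m ≤ 5 * D) (sym (∣∣≡∑ S))
    (edge-count-bound (_∈? S) inc? D 0<D proj₁
      -- The edges at y are neighbours of y in G, so the multigraph degree is at most the degree in
      -- G.
      (λ y → ≤-trans (∑-mono-≤ (λ v → ⟦⟧-mono (inc? v y) (adj? G y v) (λ (_ , vy , _) → symm G vy)))
                     (≤-trans (degree-sum y) Δ≤D))
      (λ v → ≤-trans (∑-mono-≤ (λ y → ⟦⟧-mono (inc? v y) (later? v y) proj₂)) (later-count v))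
      (λ v v∈S → ≤-trans (disjoint-count v v∈S) Δ≤D))

-- In the unnormalised rationals the order is integer cross-multiplication, so the claim becomes m *
-- 2 ≤ 5 * D * 1.
2m≤5D⇒m/1≤5/2*D/1 : ∀ m D → 2 * m ≤ 5 * D → (+ m / 1) ℚ.≤ (+ 5 / 2) ℚ.* (+ D / 1)
2m≤5D⇒m/1≤5/2*D/1 m D 2m≤5D = ℚₚ.toℚᵘ-cancel-≤ (begin
  ℚ.toℚᵘ (+ m / 1)                     ≃⟨ ℚₚ.toℚᵘ-fromℚᵘ (mkℚᵘ (+ m) 0) ⟩
  mkℚᵘ (+ m) 0                         ≤⟨ *≤* (subst₂ ℤ._≤_ lhs rhs (+≤+ 2m≤5D)) ⟩
  mkℚᵘ (+ 5) 1 ℚᵘ.* mkℚᵘ (+ D) 0       ≃⟨ ℚᵘₚ.*-congˡ {mkℚᵘ (+ 5) 1} (ℚₚ.toℚᵘ-fromℚᵘ (mkℚᵘ (+ D) 0)) ⟨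
  ℚ.toℚᵘ (+ 5 / 2) ℚᵘ.* ℚ.toℚᵘ (+ D / 1) ≃⟨ ℚₚ.toℚᵘ-homo-* (+ 5 / 2) (+ D / 1) ⟨
  ℚ.toℚᵘ ((+ 5 / 2) ℚ.* (+ D / 1))     ∎)
  where
  open ℚᵘₚ.≤-Reasoning
  lhs : + (2 * m) ≡ + m ℤ.* + 2
  lhs = trans (cong (λ t → + t) (*-comm 2 m)) (ℤₚ.pos-* m 2)
  rhs : + (5 * D) ≡ + 5 ℤ.* + D ℤ.* + 1
  rhs = trans (ℤₚ.pos-* 5 D) (sym (ℤₚ.*-identityʳ (+ 5 ℤ.* + D)))

theorem3 : ∀ (D : ℕ) → D > 0 → ∀ {n : ℕ} (G : Graph n) → Δ G ≤ D →
    ∃[ S ] (MaximumClique (G ²) S × Nice G S) →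
    (+ ω (G ²) / 1) ℚ.≤ (+ 5 / 2) ℚ.* (+ D / 1)
theorem3 D D>0 G Δ≤D (S , maximum , clique , independent , π , degenerate , consecutive) =
  2m≤5D⇒m/1≤5/2*D/1 (ω (G ²)) D (≤-trans (*-monoʳ-≤ 2 (maximumClique⇒ω≤ (G ²) maximum))
    (nice⇒2∣S∣≤5D G S π clique independent degenerate consecutive D>0 Δ≤D))
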